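{- With $(y)_n$ denoting the number of permutations in $F_n(321,3124)$ with label $(y)$, for all $n\ge0$ and all $k\ge2$ the following hold. (i) $(1a)_n=F_{n-2}$. (ii) $(1b)_n=F_{n+1}-n-1$. (iii) $(k)_n=F_{n-k-1}$. (iv) $|F_n(321,3124)|=F_{n+2}-n-1$.
   Context: $F_n$ (without arguments) is the Fibonacci number with the following indexing: $F_n=0$ for $n<-2$, $F_{ -2}=1$, $F_{ -1}=0$, and $F_n=F_{n-1}+F_{n-2}$ for $n\ge0$ (so $F_0=F_1=1$). A Fishburn permutation is a permutation $\pi$ (in one-line notation) with no subsequence $\pi_j,\pi_{j+1},\pi_k$ such that $j+1<k$, $\pi_j=\pi_k+1$, and $\pi_{j+1}>\pi_j$. $F_n(321,3124)$ is the set of Fishburn permutations of length $n$ avoiding the classical patterns $321$ and $3124$ (i.e. having no subsequence with the same relative order as either). Labels: a permutation $\pi\in F_n(321,3124)$ with $n\ge1$ has label (1a) if $n\ge 2$, $\pi_{n-1}=n$ and $\pi_n=n-1$; (1b) if $\pi$ contains $312$; (k), for an integer $k\ge2$, if $\pi$ avoids $312$ and either the rightmost $k$ entries of $\pi$ are $a,n-k+2,n-k+3,\ldots,n$ with $a\le n-k$, or $\pi=12\cdots n$ and $k=n+1$. The empty permutation is given label (1a). -}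

module Defs where

open import Data.Fin.Base using (Fin; cast)
open import Data.Integer.Base as ℤ using (ℤ; +_; -[1+_])
open import Data.List.Base using (List; []; _∷_; _++_; length; lookup; applyUpTo)
open import Data.List.Membership.Propositional using (_∈_)
open import Data.List.Relation.Binary.Permutation.Propositional using (_↭_)
open import Data.List.Relation.Binary.Sublist.Propositional using (_⊆_)
open import Data.List.Relation.Unary.Unique.Propositional using (Unique)
open import Data.Nat.Base using (ℕ; zero; suc; _+_; _∸_; _≤_; _<_)
open import Data.Product.Base using (Σ; ∃; _×_)
open import Data.Sum.Base using (_⊎_)
open import Function.Bundles using (_⇔_)
open import Relation.Binary.PropositionalEquality using (_≡_; refl)
open import Relation.Nullary.Negation using (¬_)

-- Fibonacci numbers indexed so that F 0 = F 1 = 1.  The recurrence is unfolded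
-- at 0 and 1 for the termination checker; F-rec confirms it on all n ≥ 0.
F : ℤ → ℕ
F (+ 0)                  = 1
F (+ 1)                  = 1
F (+ suc (suc n))        = F (+ suc n) + F (+ n)
F -[1+ 0 ]               = 0
F -[1+ 1 ]               = 1
F -[1+ suc (suc n) ]     = 0

F-rec : ∀ n → F (+ n) ≡ F (+ n ℤ.- + 1) + F (+ n ℤ.- + 2)
F-rec 0             = refl
F-rec 1             = refl
F-rec (suc (suc n)) = refl

-- a , a + 1 , … , b  (empty when b < a)
interval : ℕ → ℕ → List ℕ
interval a b = applyUpTo (λ i → a + i) (suc b ∸ a)

-- Permutations are in one-line notation, with values 1, …, n.
IsPermutation : ℕ → List ℕ → Set
IsPermutation n π = π ↭ interval 1 n

OrderIsomorphic : List ℕ → List ℕ → Set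
OrderIsomorphic σ τ = Σ (length σ ≡ length τ) λ eq →
  (i j : Fin (length σ)) →
    lookup σ i < lookup σ j ⇔ lookup τ (cast eq i) < lookup τ (cast eq j)

-- _⊆_ is the (not necessarily contiguous) subsequence relation.
Contains : List ℕ → List ℕ → Set
Contains π σ = ∃ λ τ → τ ⊆ π × OrderIsomorphic σ τ

Avoids : List ℕ → List ℕ → Set
Avoids π σ = ¬ Contains π σ

-- In the decomposition, a = π_j and b = π_{j+1} are adjacent, and c = π_k is
-- any entry to the right of both.
FishburnPattern : List ℕ → Set
FishburnPattern π = ∃ λ xs → ∃ λ a → ∃ λ b → ∃ λ ys → ∃ λ c →
  π ≡ xs ++ a ∷ b ∷ ys × c ∈ ys × a ≡ c + 1 × a < b

IsFishburn : ℕ → List ℕ → Set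
IsFishburn n π = IsPermutation n π × ¬ FishburnPattern π

p312 p321 p3124 : List ℕ
p312  = 3 ∷ 1 ∷ 2 ∷ []
p321  = 3 ∷ 2 ∷ 1 ∷ []
p3124 = 3 ∷ 1 ∷ 2 ∷ 4 ∷ []

F[321,3124] : ℕ → List ℕ → Set
F[321,3124] n π = IsFishburn n π × Avoids π p321 × Avoids π p3124

data Label : Set where
  1a  : Label
  1b  : Label
  num : ℕ → Label

-- "a ≤ n - k" is written a + k ≤ n; since this forces k ≤ n, the subtraction
-- n ∸ k is never truncated where it matters.
HasLabel : Label → ℕ → List ℕ → Set
HasLabel 1a n π =
  (n ≡ 0 × π ≡ [])
  ⊎ (2 ≤ n × ∃ λ xs → π ≡ xs ++ n ∷ (n ∸ 1) ∷ [])
HasLabel 1b n π = 1 ≤ n × Contains π p312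
HasLabel (num k) n π = 1 ≤ n × 2 ≤ k × Avoids π p312 ×
  ((∃ λ xs → ∃ λ a → a + k ≤ n × π ≡ xs ++ a ∷ interval ((n ∸ k) + 2) n)
   ⊎ (π ≡ interval 1 n × k ≡ n + 1))

Labelled : Label → ℕ → List ℕ → Set
Labelled y n π = F[321,3124] n π × HasLabel y n π

-- The number of x satisfying P is z.  The value is an integer so that formulas
-- with subtraction can be used without truncation.
HasCardinality : {A : Set} → (A → Set) → ℤ → Set
HasCardinality {A} P z = ∃ λ (xs : List A) →
  Unique xs × (∀ x → x ∈ xs ⇔ P x) × + length xs ≡ z

{-# OPTIONS --safe #-}

-- Call members the Fishburn arrangements of an interval a, …, a + n - 1 that
-- avoid 321 and 3124, and let h be the first entry of a member.  If h = a, a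
-- shorter member follows.  If h > a, the second entry is a: a larger b ≠ a there
-- would exceed h and give the Fishburn pattern h b … h - 1, or lie below h and
-- give the 321 pattern h b a.  If h = a + 1, a shorter member follows this block
-- 21.  If h ≥ a + 2, avoiding 321 and 3124 forces everything above h to come
-- before everything else below h, both parts increasing, so the member is the
-- "hook" h, a, h + 1, …, a + n - 1, a + 1, …, h - 1.  The members are therefore
-- the direct sums of blocks 1 and 21 (those avoiding 312), and such sums followed
-- by a hook (those containing 312).  There are n - 2 hooks of length n ≥ 2, so
-- both counts obey Fibonacci-type recurrences.  Labels (1a) and (k) prescribe the
-- last entries, hence the last blocks, of a sum of blocks.

module Submission where

open import Defs
open import Data.Empty using (⊥; ⊥-elim)
open import Data.Fin.Base using (Fin; zero; suc; cast; toℕ)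
open import Data.Fin.Patterns using (0F; 1F; 2F; 3F)
open import Data.Fin.Properties using (toℕ-injective)
open import Data.Integer.Base as ℤ using (ℤ; +_)
import Data.Integer.Tactic.RingSolver as ℤ-Solver
open import Data.List.Base
  using (List; []; _∷_; _++_; length; lookup; map; iterate; applyUpTo; upTo)
open import Data.List.Properties
  using (length-++; length-map; length-upTo; ++-assoc; ++-cancelʳ;
         ∷-injectiveˡ; ∷-injectiveʳ; ∷ʳ-injective)
open import Data.List.Membership.Propositional using (_∈_)
open import Data.List.Membership.Propositional.Properties
  using (∈-map⁺; ∈-map⁻; ∈-++⁺ˡ; ∈-++⁺ʳ; ∈-++⁻; ∈-upTo⁺; ∈-upTo⁻; ∈-lookup)
open import Data.List.Relation.Binary.Permutation.Propositional
  using (_↭_; prep; swap; ↭-refl; ↭-sym; ↭-trans; ↭-reflexive; ↭⇒↭ₛ; module PermutationReasoning)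
open import Data.List.Relation.Binary.Permutation.Propositional.Properties
  using (↭-empty-inv; ∈-resp-↭; All-resp-↭; drop-∷; ¬x∷xs↭[])
  renaming (++⁺ˡ to ↭-++⁺ˡ; ++-comm to ↭-++-comm)
import Data.List.Relation.Binary.Permutation.Setoid.Properties as Permutationₛ
open import Data.List.Relation.Binary.Sublist.Propositional
  using (_⊆_; []; _∷_; _∷ʳ_; ⊆-refl; ⊆-trans; from∈; to∈; minimum)
  renaming (lookup to ⊆-lookup)
open import Data.List.Relation.Binary.Sublist.Propositional.Properties
  using () renaming (++⁺ to ⊆-++⁺; ++⁺ˡ to ⊆-++⁺ˡ; ++⁺ʳ to ⊆-++⁺ʳ)
open import Data.List.Relation.Unary.All as All using (All; []; _∷_)
import Data.List.Relation.Unary.All.Properties as All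
open import Data.List.Relation.Unary.AllPairs as AllPairs using (AllPairs; []; _∷_)
import Data.List.Relation.Unary.AllPairs.Properties as AllPairs
open import Data.List.Relation.Unary.Any using (here; there)
open import Data.List.Relation.Unary.Unique.Propositional using (Unique)
import Data.List.Relation.Unary.Unique.Propositional.Properties as Unique
open import Data.Nat.Base
open import Data.Nat.Properties
import Data.Nat.Tactic.RingSolver as ℕ-Solver
open import Data.Product.Base using (∃; ∃₂; _×_; _,_; proj₁; proj₂)
open import Data.Sum.Base using (_⊎_; inj₁; inj₂; [_,_]′)
open import Function.Base using (_∘_; id; case_of_)
open import Function.Bundles using (_⇔_; mk⇔; module Equivalence)
open import Relation.Binary.Definitions using (tri<; tri≈; tri>)
open import Relation.Binary.PropositionalEquality
  using (_≡_; _≢_; refl; sym; trans; cong; cong₂; subst; setoid; ≢-sym)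
open import Relation.Nullary.Decidable using (from-yes)
open import Relation.Nullary.Negation using (¬_; contradiction)

open Equivalence using (to; from)

private
  variable
    A B : Set
    a b c h k l m n p q w x y z : ℕ
    xs ys zs π ρ σ τ : List ℕ

-- Cardinalities

cardinality-resp-⇔ : {P Q : A → Set} {z : ℤ} → (∀ x → P x ⇔ Q x) →
                     HasCardinality P z → HasCardinality Q z
cardinality-resp-⇔ P⇔Q (xs , unique , ∈⇔P , eq) =
  xs , unique ,
  (λ x → mk⇔ (to (P⇔Q x) ∘ to (∈⇔P x)) (from (∈⇔P x) ∘ from (P⇔Q x))) , eq

cardinality-⊎ : {P Q : A → Set} {z w : ℤ} → (∀ x → P x → ¬ Q x) →
                HasCardinality P z → HasCardinality Q w →
                HasCardinality (λ x → P x ⊎ Q x) (z ℤ.+ w)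
cardinality-⊎ disjoint (xs , uniqueˣ , ∈⇔P , eqˣ) (ys , uniqueʸ , ∈⇔Q , eqʸ) =
  xs ++ ys ,
  Unique.++⁺ uniqueˣ uniqueʸ (λ (x∈xs , x∈ys) →
    disjoint _ (to (∈⇔P _) x∈xs) (to (∈⇔Q _) x∈ys)) ,
  (λ x → mk⇔
    ([ inj₁ ∘ to (∈⇔P x) , inj₂ ∘ to (∈⇔Q x) ]′ ∘ ∈-++⁻ xs)
    [ ∈-++⁺ˡ ∘ from (∈⇔P x) , ∈-++⁺ʳ xs ∘ from (∈⇔Q x) ]′) ,
  trans (cong +_ (length-++ xs)) (cong₂ ℤ._+_ eqˣ eqʸ)

Image : (A → B) → (A → Set) → B → Set
Image g P y = ∃ λ x → P x × y ≡ g x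

cardinality-image : {P : A → Set} {z : ℤ} (g : A → B) → (∀ {x y} → g x ≡ g y → x ≡ y) →
                    HasCardinality P z → HasCardinality (Image g P) z
cardinality-image g injective (xs , unique , ∈⇔P , eq) =
  map g xs , Unique.map⁺ injective unique ,
  (λ y → mk⇔
    (λ y∈ → let x , x∈xs , y≡gx = ∈-map⁻ g y∈ in x , to (∈⇔P x) x∈xs , y≡gx)
    (λ { (x , Px , refl) → ∈-map⁺ g (from (∈⇔P x) Px) })) ,
  trans (cong +_ (length-map g xs)) eq

cardinality-∅ : {P : A → Set} → (∀ x → ¬ P x) → HasCardinality P (+ 0)
cardinality-∅ ¬P = [] , [] , (λ x → mk⇔ (λ ()) (⊥-elim ∘ ¬P x)) , refl

cardinality-singleton : {P : A → Set} (x : A) → (∀ y → P y ⇔ y ≡ x) → HasCardinality P (+ 1)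
cardinality-singleton x P⇔≡ =
  x ∷ [] , [] ∷ [] ,
  (λ y → mk⇔ (λ { (here y≡x) → from (P⇔≡ y) y≡x ; (there ()) }) (here ∘ to (P⇔≡ y))) , refl

cardinality-< : ∀ n → HasCardinality (_< n) (+ n)
cardinality-< n =
  upTo n , Unique.upTo⁺ n , (λ x → mk⇔ ∈-upTo⁻ ∈-upTo⁺) , cong +_ (length-upTo n)

-- Ordered pairs of entries of a list

module _ {R : ℕ → ℕ → Set} where

  AllPairs-tabulate : (∀ {x y} → x ∷ y ∷ [] ⊆ xs → R x y) → AllPairs R xs
  AllPairs-tabulate {[]}     r = []
  AllPairs-tabulate {x ∷ xs} r =
    All.tabulate (λ y∈xs → r (refl ∷ from∈ y∈xs)) ∷ AllPairs-tabulate (r ∘ (x ∷ʳ_))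

  AllPairs-lookup : AllPairs R xs → x ∷ y ∷ [] ⊆ xs → R x y
  AllPairs-lookup (_  ∷ rs) (_ ∷ʳ s)   = AllPairs-lookup rs s
  AllPairs-lookup (rx ∷ _)  (refl ∷ s) = All.lookup rx (to∈ s)

  -- If the heads differed, each would occur later in the other list, so they would be related both
  -- ways, against asymmetry. This identifies the tail of a hook from its entries and `After`.
  AllPairs-↭⇒≡ : (∀ {x y} → R x y → ¬ R y x) →
                 AllPairs R xs → AllPairs R ys → xs ↭ ys → xs ≡ ys
  AllPairs-↭⇒≡ asym []        _         xs↭ys = sym (↭-empty-inv (↭-sym xs↭ys))
  AllPairs-↭⇒≡ asym (_ ∷ _)   []        xs↭ys = contradiction xs↭ys ¬x∷xs↭[]
  AllPairs-↭⇒≡ asym (rx ∷ rs) (ry ∷ ss) xs↭ys with ∈-resp-↭ xs↭ys (here refl)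
  ... | here refl = cong (_ ∷_) (AllPairs-↭⇒≡ asym rs ss (drop-∷ xs↭ys))
  ... | there x∈ys with ∈-resp-↭ (↭-sym xs↭ys) (here refl)
  ...   | here refl  = contradiction (All.lookup ry x∈ys) (asym (All.lookup ry x∈ys))
  ...   | there y∈xs = contradiction (All.lookup ry x∈ys) (asym (All.lookup rx y∈xs))

pair-order : x ∈ xs → y ∈ xs → x ≢ y → x ∷ y ∷ [] ⊆ xs ⊎ y ∷ x ∷ [] ⊆ xs
pair-order (here refl) (here refl) x≢y = contradiction refl x≢y
pair-order (here refl) (there y∈)  x≢y = inj₁ (refl ∷ from∈ y∈)
pair-order (there x∈)  (here refl) x≢y = inj₂ (refl ∷ from∈ x∈)
pair-order (there x∈)  (there y∈)  x≢y =
  [ inj₁ ∘ (_ ∷ʳ_) , inj₂ ∘ (_ ∷ʳ_) ]′ (pair-order x∈ y∈ x≢y)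

-- The position of `z` relative to `y` decides: after `y` it completes the triple; before `y`, on
-- either side of `x`, it gives the pair.
triple-order : x ∷ y ∷ [] ⊆ xs → z ∈ xs → z ≢ x → z ≢ y →
               x ∷ y ∷ z ∷ [] ⊆ xs ⊎ z ∷ y ∷ [] ⊆ xs
triple-order (_ ∷ʳ s)   (here refl) z≢x z≢y = inj₂ (refl ∷ from∈ (⊆-lookup s (there (here refl))))
triple-order (_ ∷ʳ s)   (there z∈)  z≢x z≢y =
  [ inj₁ ∘ (_ ∷ʳ_) , inj₂ ∘ (_ ∷ʳ_) ]′ (triple-order s z∈ z≢x z≢y)
triple-order (refl ∷ s) (here refl) z≢x z≢y = contradiction refl z≢x
triple-order (refl ∷ s) (there z∈)  z≢x z≢y =
  [ inj₁ ∘ (refl ∷_) , inj₂ ∘ (_ ∷ʳ_) ]′ (pair-order (to∈ s) z∈ (≢-sym z≢y))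

-- Permutations of ranges of consecutive integers

↭-cancelˡ : ∀ zs → zs ++ xs ↭ zs ++ ys → xs ↭ ys
↭-cancelˡ []       xs↭ys = xs↭ys
↭-cancelˡ (z ∷ zs) xs↭ys = ↭-cancelˡ zs (drop-∷ xs↭ys)

↭-cancelʳ : ∀ xs ys → xs ++ zs ↭ ys ++ zs → xs ↭ ys
↭-cancelʳ {zs} xs ys p =
  ↭-cancelˡ zs (↭-trans (↭-++-comm zs xs) (↭-trans p (↭-++-comm ys zs)))

Unique-resp-↭ : xs ↭ ys → Unique xs → Unique ys
Unique-resp-↭ p = Permutationₛ.Unique-resp-↭ (setoid ℕ) (↭⇒↭ₛ p)

-- Unlike interval, indexed by length.
range : ℕ → ℕ → List ℕ
range = iterate suc

applyUpTo-+≡range : ∀ a n → (f : ℕ → ℕ) → (∀ i → f i ≡ i + a) → applyUpTo f n ≡ range a n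
applyUpTo-+≡range a zero    f eq = refl
applyUpTo-+≡range a (suc n) f eq =
  cong₂ _∷_ (eq 0) (applyUpTo-+≡range (suc a) n (f ∘ suc) λ i → trans (eq (suc i)) (sym (+-suc i a)))

interval≡range : ∀ a b → interval a b ≡ range a (suc b ∸ a)
interval≡range a b = applyUpTo-+≡range a (suc b ∸ a) (λ i → a + i) (+-comm a)

range-++ : ∀ a m n → range a (m + n) ≡ range a m ++ range (m + a) n
range-++ a zero    n = refl
range-++ a (suc m) n =
  cong (a ∷_) (trans (range-++ (suc a) m n) (cong (λ b → range (suc a) m ++ range b n) (+-suc m a)))

∈-range⁺ : ∀ n → a ≤ x → x < n + a → x ∈ range a n
∈-range⁺ zero a≤x x<a = contradiction a≤x (<⇒≱ x<a)
∈-range⁺ {a} {x} (suc n) a≤x x<n+a with m≤n⇒m<n∨m≡n a≤x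
... | inj₁ a<x  = there (∈-range⁺ n a<x (subst (x <_) (sym (+-suc n a)) x<n+a))
... | inj₂ refl = here refl

range-lower : ∀ a n → All (a ≤_) (range a n)
range-lower a zero    = []
range-lower a (suc n) = ≤-refl ∷ All.map <⇒≤ (range-lower (suc a) n)

range-upper : ∀ a n → All (_< n + a) (range a n)
range-upper a zero    = []
range-upper a (suc n) =
  s≤s (m≤n+m a n) ∷ All.map (λ {x} → subst (x <_) (+-suc n a)) (range-upper (suc a) n)

range-increasing : ∀ a n → AllPairs _<_ (range a n)
range-increasing a zero    = []
range-increasing a (suc n) = range-lower (suc a) n ∷ range-increasing (suc a) n

module _ (π↭range : π ↭ range a n) where

  range-↭-lower : All (a ≤_) π
  range-↭-lower = All-resp-↭ (↭-sym π↭range) (range-lower a n)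

  range-↭-upper : All (_< n + a) π
  range-↭-upper = All-resp-↭ (↭-sym π↭range) (range-upper a n)

  range-↭-∈ : a ≤ x → x < n + a → x ∈ π
  range-↭-∈ a≤x x<n+a = ∈-resp-↭ (↭-sym π↭range) (∈-range⁺ n a≤x x<n+a)

  range-↭-unique : Unique π
  range-↭-unique =
    Unique-resp-↭ (↭-sym π↭range) (AllPairs.map <⇒≢ (range-increasing a n))

-- Pattern containment

contains-resp-⊆ : π ⊆ ρ → Contains π σ → Contains ρ σ
contains-resp-⊆ π⊆ρ (τ , τ⊆π , τ≅σ) = τ , ⊆-trans τ⊆π π⊆ρ , τ≅σ

lookup-mono-< : AllPairs _<_ xs → (i j : Fin (length xs)) → toℕ i < toℕ j → lookup xs i < lookup xs j
lookup-mono-< (x< ∷ _)  zero    (suc j) _         = All.lookup x< (∈-lookup j)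
lookup-mono-< (_ ∷ xs↗) (suc i) (suc j) (s<s i<j) = lookup-mono-< xs↗ i j i<j

lookup-<⇔ : AllPairs _<_ xs → (i j : Fin (length xs)) →
            suc (toℕ i) < suc (toℕ j) ⇔ lookup xs i < lookup xs j
lookup-<⇔ {xs} xs↗ i j = mk⇔ (λ { (s<s i<j) → lookup-mono-< xs↗ i j i<j }) λ xsᵢ<xsⱼ →
  case <-cmp (toℕ i) (toℕ j) of λ where
    (tri< i<j _ _) → s<s i<j
    (tri≈ _ i≡j _) → contradiction xsᵢ<xsⱼ (<-irrefl (cong (lookup xs) (toℕ-injective i≡j)))
    (tri> _ _ j<i) → contradiction xsᵢ<xsⱼ (<-asym (lookup-mono-< xs↗ j i j<i))

-- Naming the common preimage `x` absorbs the `cast`, so that an equivalence on `A` transfers to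
-- positions by rewriting.
lookup-map₂ : (f g : A → ℕ) → ∀ xs .(eq : length (map f xs) ≡ length (map g xs)) i →
              ∃ λ x → lookup (map f xs) i ≡ f x × lookup (map g xs) (cast eq i) ≡ g x
lookup-map₂ f g (x ∷ xs) eq zero    = x , refl , refl
lookup-map₂ f g (x ∷ xs) eq (suc i) = lookup-map₂ f g xs (suc-injective eq) i

map-order-isomorphic : {f g : A → ℕ} → (∀ x y → f x < f y ⇔ g x < g y) →
                       ∀ xs → OrderIsomorphic (map f xs) (map g xs)
map-order-isomorphic {f = f} {g} f⇔g xs = eq , f⇔gᵢ
  where
  eq = trans (length-map f xs) (sym (length-map g xs))
  f⇔gᵢ : ∀ i j → lookup (map f xs) i < lookup (map f xs) j ⇔
                 lookup (map g xs) (cast eq i) < lookup (map g xs) (cast eq j)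
  f⇔gᵢ i j with lookup-map₂ f g xs eq i | lookup-map₂ f g xs eq j
  ... | x , fx , gx | y , fy , gy rewrite fx | gx | fy | gy = f⇔g x y

-- The pattern is listed by the ranks of its entries, xs being the entries in increasing order.
contains-pattern : AllPairs _<_ xs → (ranks : List (Fin (length xs))) → map (lookup xs) ranks ⊆ π →
                   Contains π (map (suc ∘ toℕ) ranks)
contains-pattern xs↗ ranks s = _ , s , map-order-isomorphic (lookup-<⇔ xs↗) ranks

contains-321 : x ∷ y ∷ z ∷ [] ⊆ π → y < x → z < y → Contains π p321
contains-321 s y<x z<y =
  contains-pattern ((z<y ∷ <-trans z<y y<x ∷ []) ∷ (y<x ∷ []) ∷ [] ∷ []) (2F ∷ 1F ∷ 0F ∷ []) s

contains-312 : x ∷ y ∷ z ∷ [] ⊆ π → y < z → z < x → Contains π p312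
contains-312 s y<z z<x =
  contains-pattern ((y<z ∷ <-trans y<z z<x ∷ []) ∷ (z<x ∷ []) ∷ [] ∷ []) (2F ∷ 0F ∷ 1F ∷ []) s

contains-3124 : w ∷ x ∷ y ∷ z ∷ [] ⊆ π → x < y → y < w → w < z → Contains π p3124
contains-3124 s x<y y<w w<z = contains-pattern
  ((x<y ∷ <-trans x<y y<w ∷ <-trans x<y (<-trans y<w w<z) ∷ []) ∷
   (y<w ∷ <-trans y<w w<z ∷ []) ∷ (w<z ∷ []) ∷ [] ∷ [])
  (2F ∷ 0F ∷ 1F ∷ 3F ∷ []) s

contains-321⁻¹ : Contains π p321 → ∃ λ x → ∃ λ y → ∃ λ z → x ∷ y ∷ z ∷ [] ⊆ π × y < x × z < y
contains-321⁻¹ (x ∷ y ∷ z ∷ [] , s , eq , iso) =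
  x , y , z , s , to (iso 1F 0F) (from-yes (2 <? 3)) , to (iso 2F 1F) (from-yes (1 <? 2))

contains-312⁻¹ : Contains π p312 → ∃ λ x → ∃ λ y → ∃ λ z → x ∷ y ∷ z ∷ [] ⊆ π × y < z × z < x
contains-312⁻¹ (x ∷ y ∷ z ∷ [] , s , eq , iso) =
  x , y , z , s , to (iso 1F 2F) (from-yes (1 <? 2)) , to (iso 2F 0F) (from-yes (2 <? 3))

contains-3124⁻¹ : Contains π p3124 → ∃ λ w → ∃ λ x → ∃ λ y → ∃ λ z →
                  w ∷ x ∷ y ∷ z ∷ [] ⊆ π × x < y × y < w × w < z
contains-3124⁻¹ (w ∷ x ∷ y ∷ z ∷ [] , s , eq , iso) =
  w , x , y , z , s , to (iso 1F 2F) (from-yes (1 <? 2)) ,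
  to (iso 2F 0F) (from-yes (2 <? 3)) , to (iso 0F 3F) (from-yes (3 <? 4))

-- If `h` took part in the occurrence, it would play `p`, and the entries playing `q` and `m` would
-- be two later entries below `h`. The patterns 321, 312 and 3124 all have this shape.
contains-∷⁻ : (∀ {y z} → y ∷ z ∷ [] ⊆ π → y < h → z < h → ⊥) → q < p → m < p →
              Contains (h ∷ π) (p ∷ q ∷ m ∷ σ) → Contains π (p ∷ q ∷ m ∷ σ)
contains-∷⁻ one q<p m<p (x ∷ y ∷ z ∷ τ , _ ∷ʳ s , iso) = x ∷ y ∷ z ∷ τ , s , iso
contains-∷⁻ one q<p m<p (x ∷ y ∷ z ∷ τ , refl ∷ s , eq , iso) =
  ⊥-elim (one (⊆-trans (refl ∷ refl ∷ minimum τ) s) (to (iso 1F 0F) q<p) (to (iso 2F 0F) m<p))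

-- A Fishburn pattern involves adjacent entries, so it does not pass from arbitrary subsequences to
-- the whole list as `Contains` does; prepending and appending preserve adjacency.
fishburn-∷⁺ : FishburnPattern π → FishburnPattern (h ∷ π)
fishburn-∷⁺ (xs , a , b , ys , c , refl , c∈ys , a≡c+1 , a<b) =
  _ ∷ xs , a , b , ys , c , refl , c∈ys , a≡c+1 , a<b

fishburn-∷⁻ : (∀ {b ys} → π ≡ b ∷ ys → h < b → ∀ {c} → c ∈ ys → h ≢ suc c) →
              FishburnPattern (h ∷ π) → FishburnPattern π
fishburn-∷⁻ h≢ ([] , _ , b , ys , c , refl , c∈ys , a≡c+1 , a<b) =
  contradiction (trans a≡c+1 (+-comm c 1)) (h≢ refl a<b c∈ys)
fishburn-∷⁻ h≢ (_ ∷ xs , a , b , ys , c , refl , c∈ys , a≡c+1 , a<b) =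
  xs , a , b , ys , c , refl , c∈ys , a≡c+1 , a<b

fishburn-++ : ∀ ρ → FishburnPattern π → FishburnPattern (π ++ ρ)
fishburn-++ ρ (xs , a , b , ys , c , refl , c∈ys , a≡c+1 , a<b) =
  xs , a , b , ys ++ ρ , c , ++-assoc xs (a ∷ b ∷ ys) ρ , ∈-++⁺ˡ c∈ys , a≡c+1 , a<b

-- Forgetting the ascent leaves a pair descending by one; hooks are shown to be Fishburn by
-- excluding such pairs from their tails.
fishburn-pair : FishburnPattern π → ∃ λ c → suc c ∷ c ∷ [] ⊆ π
fishburn-pair (xs , a , b , ys , c , refl , c∈ys , a≡c+1 , a<b) =
  c , ⊆-++⁺ˡ xs (trans (sym (+-comm c 1)) (sym a≡c+1) ∷ b ∷ʳ from∈ c∈ys)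

-- Members on shifted intervals of values

Class : ℕ → ℕ → List ℕ → Set
Class a n π = (π ↭ range a n × ¬ FishburnPattern π) × Avoids π p321 × Avoids π p3124

F[321,3124]⇔Class : ∀ n π → F[321,3124] n π ⇔ Class 1 n π
F[321,3124]⇔Class n π rewrite interval≡range 1 n = mk⇔ id id

-- `ρ` uses up the top `k` values, so cancelling it leaves exactly the lowest `m` for `σ`. This
-- removes the final entries that a label prescribes.
class-prefix : ∀ σ → m + k ≡ n → m + a ≡ b → ρ ↭ range b k → Class a n (σ ++ ρ) → Class a m σ
class-prefix {m} {k} {a = a} {ρ = ρ} σ refl refl ρ↭ ((σρ↭ , ¬fish) , ¬321 , ¬3124) =
  (↭-cancelʳ σ (range a m)
     (↭-trans (↭-++⁺ˡ σ (↭-sym ρ↭)) (↭-trans σρ↭ (↭-reflexive (range-++ a m k)))) ,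
   ¬fish ∘ fishburn-++ ρ) ,
  ¬321 ∘ contains-resp-⊆ σ⊆ , ¬3124 ∘ contains-resp-⊆ σ⊆
  where
  σ⊆ : σ ⊆ σ ++ ρ
  σ⊆ = ⊆-++⁺ʳ ρ ⊆-refl

class-∷⁻ : Class a (suc n) (a ∷ π) → Class (suc a) n π
class-∷⁻ ((π↭ , ¬fish) , ¬321 , ¬3124) =
  (drop-∷ π↭ , ¬fish ∘ fishburn-∷⁺) ,
  ¬321 ∘ contains-resp-⊆ (_ ∷ʳ ⊆-refl) , ¬3124 ∘ contains-resp-⊆ (_ ∷ʳ ⊆-refl)

class-∷∷⁻ : Class a (suc (suc n)) (suc a ∷ a ∷ π) → Class (suc (suc a)) n π
class-∷∷⁻ ((π↭ , ¬fish) , ¬321 , ¬3124) =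
  (drop-∷ (drop-∷ (↭-trans (swap _ _ ↭-refl) π↭)) , ¬fish ∘ fishburn-∷⁺ ∘ fishburn-∷⁺) ,
  ¬321 ∘ contains-resp-⊆ (_ ∷ʳ _ ∷ʳ ⊆-refl) , ¬3124 ∘ contains-resp-⊆ (_ ∷ʳ _ ∷ʳ ⊆-refl)

one-below-1 : All (a <_) π → y ∷ z ∷ [] ⊆ π → y < a → z < a → ⊥
one-below-1 a<π s y<a _ = <-asym y<a (All.lookup a<π (to∈ s))

-- Only `a` itself lies below `suc a`, so no two later entries do; this is what `contains-∷⁻` asks
-- of the head of a block 21.
one-below-21 : All (suc a <_) π → y ∷ z ∷ [] ⊆ a ∷ π → y < suc a → z < suc a → ⊥
one-below-21 a<π (_ ∷ʳ s)   y< z< = one-below-1 a<π s y< z<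
one-below-21 a<π (refl ∷ s) _  z< = <-asym z< (All.lookup a<π (to∈ s))

class-∷⁺ : Class (suc a) n π → Class a (suc n) (a ∷ π)
class-∷⁺ {a} {n} {π} ((π↭ , ¬fish) , ¬321 , ¬3124) =
  (prep a π↭ , ¬fish ∘ fishburn-∷⁻ λ { refl _ c∈ refl → <-asym (n<1+n _) (All.lookup a<π (there c∈)) }) ,
  ¬321 ∘ contains-∷⁻ (one-below-1 a<π) (from-yes (2 <? 3)) (from-yes (1 <? 3)) ,
  ¬3124 ∘ contains-∷⁻ (one-below-1 a<π) (from-yes (1 <? 3)) (from-yes (2 <? 3))
  where
  a<π : All (a <_) π
  a<π = range-↭-lower π↭

class-∷∷⁺ : Class (suc (suc a)) n π → Class a (suc (suc n)) (suc a ∷ a ∷ π)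
class-∷∷⁺ {a} {n} {π} ((π↭ , ¬fish) , ¬321 , ¬3124) =
  (↭-trans (swap _ _ ↭-refl) (prep a (prep (suc a) π↭)) ,
   -- From right to left: `suc a` is followed by the smaller `a`, and a pattern starting at `a`
   -- would need a later entry below `a`.
   ¬fish ∘ fishburn-∷⁻ (λ { refl _ c∈ refl → <-asym (n<1+n _) (<-trans (n<1+n _) (All.lookup a<π (there c∈))) })
         ∘ fishburn-∷⁻ (λ { refl 1+a<a _ → contradiction 1+a<a (<-asym (n<1+n _)) })) ,
  ¬321 ∘ tail (from-yes (2 <? 3)) (from-yes (1 <? 3)) ,
  ¬3124 ∘ tail (from-yes (1 <? 3)) (from-yes (2 <? 3))
  where
  a<π : All (suc a <_) π
  a<π = range-↭-lower π↭
  tail : q < p → m < p → Contains (suc a ∷ a ∷ π) (p ∷ q ∷ m ∷ σ) → Contains π (p ∷ q ∷ m ∷ σ)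
  tail q<p m<p = contains-∷⁻ (one-below-1 (All.map <⇒≤ a<π)) q<p m<p
               ∘ contains-∷⁻ (one-below-21 a<π) q<p m<p

-- Block decompositions

-- Direct sums of blocks 1 and 21, followed by a final block satisfying T.
data Blocks (T : ℕ → ℕ → List ℕ → Set) : ℕ → ℕ → List ℕ → Set where
  end  : T a n π → Blocks T a n π
  1⊕_  : Blocks T (suc a) n π → Blocks T a (suc n) (a ∷ π)
  21⊕_ : Blocks T (suc (suc a)) n π → Blocks T a (suc (suc n)) (suc a ∷ a ∷ π)

data Empty : ℕ → ℕ → List ℕ → Set where
  empty : Empty a 0 []

-- `q` entries exceed the first entry `2 + p + a`, and `1 + p` lie strictly between `a` and it; the
-- `1 +` excludes the block 21.
hook : ℕ → ℕ → ℕ → List ℕ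
hook a p q = 2 + p + a ∷ a ∷ range (3 + p + a) q ++ range (1 + a) (1 + p)

data Hook : ℕ → ℕ → List ℕ → Set where
  mk : ∀ p q → Hook a (3 + p + q) (hook a p q)

Layered Hooked : ℕ → ℕ → List ℕ → Set
Layered = Blocks Empty
Hooked  = Blocks Hook

-- Membership of sums of blocks

blocks-class : {T : ℕ → ℕ → List ℕ → Set} → (∀ {a n π} → T a n π → Class a n π) →
               Blocks T a n π → Class a n π
blocks-class T⇒Class (end t)  = T⇒Class t
blocks-class T⇒Class (1⊕ bs)  = class-∷⁺ (blocks-class T⇒Class bs)
blocks-class T⇒Class (21⊕ bs) = class-∷∷⁺ (blocks-class T⇒Class bs)

-- x may precede y among the entries that follow h and the minimum in a hook
-- with first entry h: first those above h, then those below h, each in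
-- increasing order.
After : ℕ → ℕ → ℕ → Set
After h x y = (x < y × (x < h → y < h)) ⊎ (y < h × h < x)

after-asym : After h x y → ¬ After h y x
after-asym (inj₁ (x<y , _))    (inj₁ (y<x , _))     = <-asym x<y y<x
after-asym (inj₁ (_ , x<⇒y<)) (inj₂ (x<h , h<y))   = <-asym h<y (x<⇒y< x<h)
after-asym (inj₂ (y<h , h<x))  (inj₁ (_ , y<⇒x<))  = <-asym h<x (y<⇒x< y<h)
after-asym (inj₂ (_ , h<x))    (inj₂ (x<h , _))     = <-asym h<x x<h

hook-after : ∀ a p q → AllPairs (After (2 + p + a)) (range (3 + p + a) q ++ range (1 + a) (1 + p))
hook-after a p q = AllPairs.++⁺
  (AllPairs-tabulate λ s →
    inj₁ (AllPairs-lookup (range-increasing _ q) s ,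
          λ x<h → contradiction x<h (<-asym (All.lookup (range-lower _ q) (to∈ s)))))
  (AllPairs-tabulate λ {_} {y} s →
    inj₁ (AllPairs-lookup (range-increasing _ (1 + p)) s ,
          λ _ → below (⊆-lookup s (there (here refl)))))
  (All.tabulate λ x∈ → All.tabulate λ y∈ → inj₂ (below y∈ , All.lookup (range-lower _ q) x∈))
  where
  below : y ∈ range (1 + a) (1 + p) → y < 2 + p + a
  below {y} y∈ = subst (y <_) (cong suc (+-suc p a)) (All.lookup (range-upper (1 + a) (1 + p)) y∈)

module _ (a<π : All (a <_) π) (after : AllPairs (After h) π) where

  -- A descent after `a` passes from above `h` to below `h`, so two in a row are impossible, and so
  -- is one that starts below `h`. The minimum `a` can be neither the 3 nor the 2 of the pattern.
  hook-avoids-321 : Avoids (h ∷ a ∷ π) p321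
  hook-avoids-321 c with contains-321⁻¹ c
  ... | x , y , z , refl ∷ refl ∷ s , y<x , z<y = <-asym z<y (All.lookup a<π (to∈ s))
  ... | x , y , z , refl ∷ _ ∷ʳ s , y<x , z<y with AllPairs-lookup after s
  ...   | inj₁ (y<z , _) = <-asym y<z z<y
  ...   | inj₂ (_ , h<y) = <-asym h<y y<x
  hook-avoids-321 c | x , y , z , _ ∷ʳ refl ∷ s , y<x , z<y = <-asym y<x (All.lookup a<π (to∈ s))
  hook-avoids-321 c | x , y , z , _ ∷ʳ _ ∷ʳ s , y<x , z<y
    with AllPairs-lookup after (⊆-trans (refl ∷ refl ∷ z ∷ʳ []) s)
       | AllPairs-lookup after (⊆-trans (x ∷ʳ ⊆-refl) s)
  ... | inj₁ (x<y , _) | _              = <-asym x<y y<x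
  ... | inj₂ _         | inj₁ (y<z , _) = <-asym y<z z<y
  ... | inj₂ (y<h , _) | inj₂ (_ , h<y) = <-asym y<h h<y

  -- The 2 of a 3124 would lie below `h` and the 4 above it, whereas an entry below `h` in the tail
  -- is followed only by such entries.
  hook-avoids-3124 : Avoids (h ∷ a ∷ π) p3124
  hook-avoids-3124 c with contains-3124⁻¹ c
  ... | w , x , y , z , refl ∷ s , x<y , y<w , w<z with AllPairs-lookup after (tail₂ s)
    where
    tail₂ : x ∷ y ∷ z ∷ [] ⊆ a ∷ π → y ∷ z ∷ [] ⊆ π
    tail₂ (refl ∷ s) = s
    tail₂ (_ ∷ʳ s)   = ⊆-trans (x ∷ʳ ⊆-refl) s
  ...   | inj₁ (_ , y<⇒z<) = <-asym w<z (y<⇒z< y<w)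
  ...   | inj₂ (_ , h<y)   = <-asym h<y y<w
  hook-avoids-3124 c | w , x , y , z , _ ∷ʳ refl ∷ s , x<y , y<w , w<z =
    <-asym (<-trans x<y y<w) (All.lookup a<π (to∈ s))
  hook-avoids-3124 c | w , x , y , z , _ ∷ʳ _ ∷ʳ s , x<y , y<w , w<z
    with AllPairs-lookup after (⊆-trans (refl ∷ x ∷ʳ refl ∷ z ∷ʳ []) s)
       | AllPairs-lookup after (⊆-trans (w ∷ʳ x ∷ʳ ⊆-refl) s)
  ... | inj₁ (w<y , _)   | _                = <-asym w<y y<w
  ... | inj₂ (y<h , h<w) | inj₁ (_ , y<⇒z<) = <-asym (<-trans h<w w<z) (y<⇒z< y<h)
  ... | inj₂ (y<h , _)   | inj₂ (_ , h<y)   = <-asym h<y y<h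

  -- A pattern inside the tail contains a descent from `suc c` to `c`, but a descent there passes
  -- strictly over `h`, and no integer lies strictly between these two.
  hook-fishburn : a < h → ¬ FishburnPattern (h ∷ a ∷ π)
  hook-fishburn a<h = tail ∘ fishburn-∷⁻ (λ { refl _ c∈π refl → <-asym (n<1+n _) (All.lookup a<π (there c∈π)) })
                           ∘ fishburn-∷⁻ (λ { refl h<a → contradiction h<a (<-asym a<h) })
    where
    tail : ¬ FishburnPattern π
    tail fish with fishburn-pair fish
    ... | c , s with AllPairs-lookup after s
    ...   | inj₁ (1+c<c , _)   = <-asym (n<1+n c) 1+c<c
    ...   | inj₂ (c<h , h<1+c) = <⇒≱ c<h (s≤s⁻¹ h<1+c)

hook-↭ : ∀ a p q → hook a p q ↭ range a (3 + p + q)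
hook-↭ a p q = begin
  2 + p + a ∷ a ∷ range (3 + p + a) q ++ range (1 + a) (1 + p) ↭⟨ swap _ _ ↭-refl ⟩
  -- After the swap, `2 + p + a` heads the run above it; exchanging the two runs then sorts the
  -- list.
  a ∷ range (2 + p + a) (1 + q) ++ range (1 + a) (1 + p)
    ↭⟨ prep a (↭-++-comm (range (2 + p + a) (1 + q)) (range (1 + a) (1 + p))) ⟩
  a ∷ range (1 + a) (1 + p) ++ range (2 + p + a) (1 + q)
    ≡⟨ cong (λ b → a ∷ range (1 + a) (1 + p) ++ range b (1 + q)) (cong suc (+-suc p a)) ⟨
  a ∷ range (1 + a) (1 + p) ++ range (1 + p + (1 + a)) (1 + q)
    ≡⟨ cong (a ∷_) (range-++ (1 + a) (1 + p) (1 + q)) ⟨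
  a ∷ range (1 + a) (1 + p + (1 + q)) ≡⟨ cong (λ n → a ∷ range (1 + a) (1 + n)) (+-suc p q) ⟩
  a ∷ range (1 + a) (2 + p + q) ∎
  where open PermutationReasoning

hook-class : Hook a n π → Class a n π
hook-class {a} (mk p q) =
  (hook-↭ a p q , hook-fishburn a<tail (hook-after a p q) (m≤n⇒m≤1+n (s≤s (m≤n+m a p)))) ,
  hook-avoids-321 a<tail (hook-after a p q) , hook-avoids-3124 a<tail (hook-after a p q)
  where
  a<tail : All (a <_) (range (3 + p + a) q ++ range (1 + a) (1 + p))
  a<tail = All.++⁺ (All.map (≤-trans (s≤s (≤-trans (m≤n+m a p) (m≤n+m (p + a) 2)))) (range-lower _ q))
                   (range-lower (1 + a) (1 + p))

empty-class : Empty a n π → Class a n π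
empty-class empty =
  (↭-refl , λ { ([] , _ , _ , _ , _ , () , _) ; (_ ∷ _ , _ , _ , _ , _ , () , _) }) ,
  (λ { (_ , [] , () , _) }) , (λ { (_ , [] , () , _) })

layered-class : Layered a n π → Class a n π
layered-class = blocks-class empty-class

hooked-class : Hooked a n π → Class a n π
hooked-class = blocks-class hook-class

layered-avoids-312 : Layered a n π → Avoids π p312
layered-avoids-312 (end empty) (_ , [] , () , _)
layered-avoids-312 (1⊕ bs) =
  layered-avoids-312 bs
  ∘ contains-∷⁻ (one-below-1 a<π) (from-yes (1 <? 3)) (from-yes (2 <? 3))
  where a<π = range-↭-lower (proj₁ (proj₁ (layered-class bs)))
layered-avoids-312 (21⊕ bs) =
  layered-avoids-312 bs
  ∘ contains-∷⁻ (one-below-1 (All.map <⇒≤ a<π)) (from-yes (1 <? 3)) (from-yes (2 <? 3))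
  ∘ contains-∷⁻ (one-below-21 a<π) (from-yes (1 <? 3)) (from-yes (2 <? 3))
  where a<π = range-↭-lower (proj₁ (proj₁ (layered-class bs)))

hooked-contains-312 : Hooked a n π → Contains π p312
hooked-contains-312 {a} (end (mk p q)) =
  contains-312 (refl ∷ refl ∷ ⊆-++⁺ˡ (range (3 + p + a) q) (refl ∷ minimum _)) (n<1+n a)
    (s≤s (s≤s (m≤n+m a p)))
hooked-contains-312 (1⊕ bs)  = contains-resp-⊆ (_ ∷ʳ ⊆-refl) (hooked-contains-312 bs)
hooked-contains-312 (21⊕ bs) = contains-resp-⊆ (_ ∷ʳ _ ∷ʳ ⊆-refl) (hooked-contains-312 bs)

-- Every member is a sum of blocks

class-second : Class a n (h ∷ π) → a < h → ∃ λ ρ → π ≡ a ∷ ρ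
class-second {a} {n} {h} {π} ((π↭ , ¬fish) , ¬321 , _) a<h
  with h<n+a ∷ _ ← range-↭-upper π↭
  with range-↭-lower π↭ | range-↭-unique π↭ | range-↭-∈ π↭ ≤-refl (<-trans a<h h<n+a)
... | _ | _ | here refl = contradiction a<h (<-irrefl refl)
... | _ | _ | there (here refl) = _ , refl
... | _ ∷ a≤b ∷ _ | (h≢b ∷ _) ∷ (b≢ ∷ _) | there (there {b} {ρ} a∈ρ) with <-cmp h b
...   | tri≈ _ h≡b _ = contradiction h≡b h≢b
...   | tri> _ _ b<h =
  contradiction (contains-321 (refl ∷ refl ∷ from∈ a∈ρ) b<h (≤∧≢⇒< a≤b (≢-sym (All.lookup b≢ a∈ρ)))) ¬321
-- Writing the first entry as `suc c` names the value that completes a Fishburn pattern with the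
-- ascent to `b`.
class-second {a} {n} {suc c} ((π↭ , ¬fish) , ¬321 , _) a<h
  | _ | _ | there (there {b} {ρ} a∈ρ) | tri< h<b _ _
  with range-↭-∈ π↭ (s≤s⁻¹ a<h) (<-trans (n<1+n c) (All.lookup (range-↭-upper π↭) (here refl)))
... | here c≡h              = contradiction c≡h (<⇒≢ (n<1+n c))
... | there (here refl)     = contradiction h<b (<-asym (n<1+n c))
... | there (there c∈ρ)     =
  contradiction ([] , suc c , b , ρ , c , refl , c∈ρ , +-comm 1 c , h<b) ¬fish

-- An entry below `h` followed by one above it would complete 3124 with `h` and `a`; a descent among
-- the entries below `h` would complete 321 with `h`.
class-after : Class a n (h ∷ a ∷ π) → suc a < h → AllPairs (After h) π
class-after {a} {n} {h} {π} ((hπ↭ , _) , ¬321 , ¬3124) 1+a<h = AllPairs-tabulate after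
  where
  hπ-unique : Unique (h ∷ a ∷ π)
  hπ-unique = range-↭-unique hπ↭

  a<π : x ∈ π → a < x
  a<π x∈π with _ ∷ _ ∷ a≤π ← range-↭-lower hπ↭ | _ ∷ (a≢π ∷ _) ← hπ-unique =
    ≤∧≢⇒< (All.lookup a≤π x∈π) (All.lookup a≢π x∈π)

  h≢π : x ∈ π → h ≢ x
  h≢π x∈π with (_ ∷ h≢π) ∷ _ ← hπ-unique = All.lookup h≢π x∈π

  -- Since `h` is at least `a + 2`, the value `a + 1` lies below `h` and occurs in the tail; it
  -- serves to exclude descents among the entries above `h`.
  1+a∈π : suc a ∈ π
  1+a∈π with range-↭-∈ hπ↭ (n≤1+n a) (<-trans 1+a<h (All.lookup (range-↭-upper hπ↭) (here refl)))
  ... | here 1+a≡h           = contradiction 1+a≡h (<⇒≢ 1+a<h)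
  ... | there (here 1+a≡a)   = contradiction (sym 1+a≡a) (<⇒≢ (n<1+n a))
  ... | there (there 1+a∈π)  = 1+a∈π

  after-small : x ∷ y ∷ [] ⊆ π → x < h → y < h
  after-small {x} {y} s x<h with <-cmp y h
  ... | tri< y<h _ _ = y<h
  ... | tri≈ _ y≡h _ = contradiction (sym y≡h) (h≢π (⊆-lookup s (there (here refl))))
  ... | tri> _ _ h<y = contradiction (contains-3124 (refl ∷ refl ∷ s) (a<π (to∈ s)) x<h h<y) ¬3124

  after : x ∷ y ∷ [] ⊆ π → After h x y
  after {x} {y} s with <-cmp x y | <-cmp y h
  ... | tri< x<y _ _ | _ = inj₁ (x<y , after-small s)
  ... | tri≈ _ refl _ | _ with _ ∷ _ ∷ π-unique ← hπ-unique =
    contradiction refl (AllPairs-lookup π-unique s)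
  ... | tri> _ _ y<x | tri≈ _ y≡h _ = contradiction (sym y≡h) (h≢π (⊆-lookup s (there (here refl))))
  ... | tri> _ _ y<x | tri< y<h _ _ with <-cmp x h
  ...   | tri< x<h _ _ = contradiction (contains-321 (refl ∷ a ∷ʳ s) x<h y<x) ¬321
  ...   | tri≈ _ x≡h _ = contradiction (sym x≡h) (h≢π (to∈ s))
  ...   | tri> _ _ h<x = inj₂ (y<h , h<x)
  -- Wherever 1 + a stands relative to y, it completes a forbidden pattern.
  after {x} {y} s | tri> _ _ y<x | tri> _ _ h<y
    with triple-order s 1+a∈π (<⇒≢ (<-trans 1+a<h (<-trans h<y y<x))) (<⇒≢ (<-trans 1+a<h h<y))
  ... | inj₁ t = contradiction (contains-321 (_ ∷ʳ _ ∷ʳ t) y<x (<-trans 1+a<h h<y)) ¬321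
  ... | inj₂ t = contradiction (after-small t 1+a<h) (<-asym h<y)

-- `h` determines `p`, the length then determines `q`, and `After` determines the order of the tail.
class-hook : Class a n (h ∷ a ∷ π) → suc a < h → Hook a n (h ∷ a ∷ π)
class-hook {a} {n} {h} {π} cls@((hπ↭ , _) , _) 1+a<h
  with p , 2+a+p≡h ← m≤n⇒∃[o]m+o≡n 1+a<h
  with refl ← trans (sym 2+a+p≡h) (cong (λ b → suc (suc b)) (+-comm a p))
  -- The bound `h < n + a` cancels to `3 + p ≤ n`.
  with q , refl ← m≤n⇒∃[o]m+o≡n (+-cancelʳ-≤ a (3 + p) n (All.lookup (range-↭-upper hπ↭) (here refl)))
  with refl ← AllPairs-↭⇒≡ after-asym (class-after cls 1+a<h) (hook-after a p q)
                (drop-∷ (drop-∷ (↭-trans hπ↭ (↭-sym (hook-↭ a p q)))))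
  = mk p q

decompose : ∀ a n π → Class a n π → Layered a n π ⊎ Hooked a n π
decompose a zero    π       ((π↭ , _) , _) with refl ← ↭-empty-inv π↭ = inj₁ (end empty)
decompose a (suc n) []      ((π↭ , _) , _) = contradiction (↭-sym π↭) ¬x∷xs↭[]
decompose a (suc n) (h ∷ π) cls@((π↭ , _) , _)
  with m≤n⇒m<n∨m≡n (All.lookup (range-↭-lower π↭) (here refl))
... | inj₂ refl = [ inj₁ ∘ 1⊕_ , inj₂ ∘ 1⊕_ ]′ (decompose (suc a) n π (class-∷⁻ cls))
... | inj₁ a<h with class-second cls a<h
...   | ρ , refl with m≤n⇒m<n∨m≡n a<h
...     | inj₁ 1+a<h = inj₂ (end (class-hook cls 1+a<h))
-- Length 1 leaves no room for the value `suc a`.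
decompose a (suc zero) (_ ∷ _) ((π↭ , _) , _) | inj₁ _ | _ , refl | inj₂ refl =
  contradiction (All.lookup (range-↭-upper π↭) (here refl)) (<-irrefl refl)
decompose a (suc (suc n)) (_ ∷ _) cls | inj₁ _ | ρ , refl | inj₂ refl =
  [ inj₁ ∘ 21⊕_ , inj₂ ∘ 21⊕_ ]′ (decompose (suc (suc a)) n ρ (class-∷∷⁻ cls))

-- The right end of a sum of blocks

layered-range : ∀ a n → Layered a n (range a n)
layered-range a zero    = end empty
layered-range a (suc n) = 1⊕ layered-range (suc a) n

layered-++ : m + k ≡ n → m + a ≡ b → Layered a m σ → Layered b k ρ → Layered a n (σ ++ ρ)
layered-++ refl refl (end empty) ρ-layered = ρ-layered
layered-++ {a = a} refl refl (1⊕_ {n = m} bs) ρ-layered =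
  1⊕ layered-++ refl (+-suc m a) bs ρ-layered
layered-++ {a = a} refl refl (21⊕_ {n = m} bs) ρ-layered =
  21⊕ layered-++ refl (trans (+-suc m (suc a)) (cong suc (+-suc m a))) bs ρ-layered

-- `Blocks` exposes the first block, whereas labels prescribe the last entries; induction from the
-- left finds the last block.
layered-unsnoc : Layered a n π →
  (n ≡ 0 × π ≡ [])
  ⊎ (∃₂ λ m σ → n ≡ suc m × Layered a m σ × π ≡ σ ++ m + a ∷ [])
  ⊎ (∃₂ λ m σ → n ≡ suc (suc m) × Layered a m σ × π ≡ σ ++ suc m + a ∷ m + a ∷ [])
layered-unsnoc (end empty) = inj₁ (refl , refl)
layered-unsnoc {a} (1⊕ bs) with layered-unsnoc bs
... | inj₁ (refl , refl) = inj₂ (inj₁ (0 , [] , refl , end empty , refl))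
... | inj₂ (inj₁ (m , σ , refl , bs′ , refl)) rewrite +-suc m a =
  inj₂ (inj₁ (suc m , a ∷ σ , refl , 1⊕ bs′ , refl))
... | inj₂ (inj₂ (m , σ , refl , bs′ , refl)) rewrite +-suc m a =
  inj₂ (inj₂ (suc m , a ∷ σ , refl , 1⊕ bs′ , refl))
layered-unsnoc {a} (21⊕ bs) with layered-unsnoc bs
... | inj₁ (refl , refl) = inj₂ (inj₂ (0 , [] , refl , end empty , refl))
... | inj₂ (inj₁ (m , σ , refl , bs′ , refl)) rewrite +-suc m (suc a) | +-suc m a =
  inj₂ (inj₁ (2 + m , suc a ∷ a ∷ σ , refl , 21⊕ bs′ , refl))
... | inj₂ (inj₂ (m , σ , refl , bs′ , refl)) rewrite +-suc m (suc a) | +-suc m a =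
  inj₂ (inj₂ (2 + m , suc a ∷ a ∷ σ , refl , 21⊕ bs′ , refl))

class-avoids-312⇒layered : Class a n π → Avoids π p312 → Layered a n π
class-avoids-312⇒layered cls ¬312 with decompose _ _ _ cls
... | inj₁ layered = layered
... | inj₂ hooked  = contradiction (hooked-contains-312 hooked) ¬312

class-contains-312⇒hooked : Class a n π → Contains π p312 → Hooked a n π
class-contains-312⇒hooked cls 312∈π with decompose _ _ _ cls
... | inj₁ layered = contradiction 312∈π (layered-avoids-312 layered)
... | inj₂ hooked  = hooked

-- Counting sums of blocks

blockCount : (ℕ → ℕ) → ℕ → ℕ
blockCount t 0             = t 0
blockCount t 1             = t 1 + blockCount t 0
blockCount t (suc (suc n)) = t (suc (suc n)) + (blockCount t (suc n) + blockCount t n)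

module _ {T : ℕ → ℕ → List ℕ → Set} {t : ℕ → ℕ} (T-count : ∀ a n → HasCardinality (T a n) (+ t n))
         (T≢1⊕ : ∀ {a n π} → ¬ T a n (a ∷ π)) (T≢21⊕ : ∀ {a n π} → ¬ T a n (suc a ∷ a ∷ π)) where

  -- A sum is a final block or starts with 1 or 21, which gives the recurrence of `blockCount`. The
  -- assumptions on `T` keep the first case apart from the others; the first entry separates the
  -- other two.
  blocks-count : ∀ a n → HasCardinality (Blocks T a n) (+ blockCount t n)
  blocks-count a 0 = cardinality-resp-⇔ (λ π → mk⇔ end λ { (end tπ) → tπ }) (T-count a 0)
  blocks-count a 1 =
    cardinality-resp-⇔
      (λ π → mk⇔ (λ { (inj₁ tπ) → end tπ ; (inj₂ (_ , bs , refl)) → 1⊕ bs })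
                 (λ { (end tπ) → inj₁ tπ ; (1⊕ bs) → inj₂ (_ , bs , refl) }))
      (cardinality-⊎ (λ { _ tπ (_ , _ , refl) → T≢1⊕ tπ })
        (T-count a 1)
        (cardinality-image (a ∷_) ∷-injectiveʳ (blocks-count (suc a) 0)))
  blocks-count a (suc (suc n)) =
    cardinality-resp-⇔
      (λ π → mk⇔ (λ { (inj₁ tπ) → end tπ
                    ; (inj₂ (inj₁ (_ , bs , refl))) → 1⊕ bs
                    ; (inj₂ (inj₂ (_ , bs , refl))) → 21⊕ bs })
                 (λ { (end tπ) → inj₁ tπ
                    ; (1⊕ bs)  → inj₂ (inj₁ (_ , bs , refl))
                    ; (21⊕ bs) → inj₂ (inj₂ (_ , bs , refl)) }))
      (cardinality-⊎ (λ { _ tπ (inj₁ (_ , _ , refl)) → T≢1⊕ tπ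
                         ; _ tπ (inj₂ (_ , _ , refl)) → T≢21⊕ tπ })
        (T-count a (suc (suc n)))
        (cardinality-⊎ (λ { _ (_ , _ , refl) (_ , _ , eq) → <⇒≢ (n<1+n a) (∷-injectiveˡ eq) })
          (cardinality-image (a ∷_) ∷-injectiveʳ (blocks-count (suc a) (suc n)))
          (cardinality-image (λ π → suc a ∷ a ∷ π) (∷-injectiveʳ ∘ ∷-injectiveʳ)
            (blocks-count (suc (suc a)) n))))

emptyCount : ℕ → ℕ
emptyCount zero    = 1
emptyCount (suc _) = 0

empty-count : ∀ a n → HasCardinality (Empty a n) (+ emptyCount n)
empty-count a zero    = cardinality-singleton [] λ π → mk⇔ (λ { empty → refl }) λ { refl → empty }
empty-count a (suc n) = cardinality-∅ λ π ()

-- A hook of length `n ≥ 3` is determined by `p`, which ranges over 0, ..., `n - 3`; `q` is what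
-- remains.
hook-count : ∀ a n → HasCardinality (Hook a n) (+ (n ∸ 2))
hook-count a 0 = cardinality-∅ λ π ()
hook-count a 1 = cardinality-∅ λ π ()
hook-count a 2 = cardinality-∅ λ π ()
hook-count a (suc (suc (suc n))) =
  cardinality-resp-⇔
    (λ π → mk⇔
      (λ { (p , p≤n , refl) →
             subst (λ m → Hook a (3 + m) (hook a p (n ∸ p))) (m+[n∸m]≡n (s≤s⁻¹ p≤n)) (mk p (n ∸ p)) })
      (λ { (mk p q) → p , s≤s (m≤m+n p q) , cong (hook a p) (sym (m+n∸m≡n p q)) }))
    (cardinality-image (λ p → hook a p (n ∸ p))
      (λ eq → +-cancelʳ-≡ a _ _ (suc-injective (suc-injective (∷-injectiveˡ eq))))
      (cardinality-< (suc n)))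

blockCount-empty : ∀ n → blockCount emptyCount n ≡ F (+ n)
blockCount-empty 0             = refl
blockCount-empty 1             = refl
blockCount-empty (suc (suc n)) = cong₂ _+_ (blockCount-empty (suc n)) (blockCount-empty n)

-- Stated additively, so that no subtraction is truncated.
blockCount-hook : ∀ n → blockCount (_∸ 2) n + suc n ≡ F (+ suc n)
blockCount-hook 0             = refl
blockCount-hook 1             = refl
blockCount-hook (suc (suc n)) =
  trans (rearrange n (blockCount (_∸ 2) (suc n)) (blockCount (_∸ 2) n))
        (cong₂ _+_ (blockCount-hook (suc n)) (blockCount-hook n))
  where
  rearrange : ∀ n i j → n + (i + j) + (3 + n) ≡ (i + (2 + n)) + (j + (1 + n))
  rearrange = ℕ-Solver.solve-∀

layered-count : ∀ a n → HasCardinality (Layered a n) (+ F (+ n))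
layered-count a n = subst (HasCardinality (Layered a n) ∘ +_) (blockCount-empty n)
  (blocks-count empty-count (λ ()) (λ ()) a n)

hooked-count : ∀ a n → HasCardinality (Hooked a n) (+ F (+ n ℤ.+ + 1) ℤ.- + n ℤ.- + 1)
hooked-count a n = subst (HasCardinality (Hooked a n)) count
  (blocks-count hook-count
    (λ hk → head≢ hk (m≤n⇒m≤1+n (n<1+n _)))
    (λ hk → head≢ hk ≤-refl) a n)
  where
  -- A hook starts at `2 + a` or higher, unlike the blocks 1 and 21.
  head≢ : ∀ {a n} → Hook a n (x ∷ π) → ¬ x < 2 + a
  head≢ (mk p q) x<2+a = <⇒≱ x<2+a (s≤s (s≤s (m≤n+m _ p)))
  cancel : ∀ i j → i ≡ i ℤ.+ (+ 1 ℤ.+ j) ℤ.- j ℤ.- + 1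
  cancel = ℤ-Solver.solve-∀
  count : + blockCount (_∸ 2) n ≡ + F (+ n ℤ.+ + 1) ℤ.- + n ℤ.- + 1
  count rewrite +-comm n 1 | sym (blockCount-hook n) = cancel (+ blockCount (_∸ 2) n) (+ n)

class-count : ∀ a n → HasCardinality (Class a n) (+ F (+ n ℤ.+ + 2) ℤ.- + n ℤ.- + 1)
class-count a n =
  cardinality-resp-⇔ (λ π → mk⇔ [ layered-class , hooked-class ]′ (decompose a n π))
    (subst (HasCardinality _) count
      (cardinality-⊎ (λ π layered hooked → layered-avoids-312 layered (hooked-contains-312 hooked))
        (layered-count a n) (hooked-count a n)))
  where
  regroup : ∀ i j k → i ℤ.+ (j ℤ.- k ℤ.- + 1) ≡ j ℤ.+ i ℤ.- k ℤ.- + 1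
  regroup = ℤ-Solver.solve-∀
  count : + F (+ n) ℤ.+ (+ F (+ n ℤ.+ + 1) ℤ.- + n ℤ.- + 1) ≡ + F (+ n ℤ.+ + 2) ℤ.- + n ℤ.- + 1
  count rewrite +-comm n 1 | +-comm n 2 = regroup (+ F (+ n)) (+ F (+ suc n)) (+ n)

-- Labels

labelled-⇔ : (y : Label) {P : List ℕ → Set} →
             (∀ π → Class 1 n π → HasLabel y n π → P π) →
             (∀ π → P π → Class 1 n π × HasLabel y n π) →
             ∀ π → P π ⇔ Labelled y n π
labelled-⇔ {n} y ⇒P P⇒ π = mk⇔
  (λ Pπ → let cls , label = P⇒ π Pπ in from (F[321,3124]⇔Class n π) cls , label)
  (λ (fπ , label) → ⇒P π (to (F[321,3124]⇔Class n π) fπ) label)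

-- Dropping the final `n`, `n - 1` leaves a member of length `n - 2`, which must avoid 312, since
-- the entry `n` would turn a 312 into a 3124. Conversely, any sum of blocks 1 and 21 may be
-- followed by 21. The lengths 0 and 1 match the values of `F` at -2 and -1.
count-1a : ∀ n → HasCardinality (Labelled 1a n) (+ F (+ n ℤ.- + 2))
count-1a 0 = cardinality-resp-⇔
  (labelled-⇔ 1a (λ { _ _ (inj₁ (_ , refl)) → empty ; _ _ (inj₂ (() , _)) })
                 (λ { _ empty → empty-class {a = 1} empty , inj₁ (refl , refl) }))
  (empty-count 1 0)
count-1a 1 = cardinality-∅ λ { _ (_ , inj₁ (() , _)) ; _ (_ , inj₂ (s≤s () , _)) }
count-1a (suc (suc n)) = cardinality-resp-⇔
  (labelled-⇔ 1a
    (λ { π cls (inj₂ (_ , σ , refl)) →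
         let clsσ = class-prefix σ (+-comm n 2) (+-comm n 1) (swap _ _ ↭-refl) cls in
         σ , class-avoids-312⇒layered clsσ (avoids σ cls clsσ) , refl })
    (λ { π (σ , layered , refl) →
         layered-class (layered-++ (+-comm n 2) (+-comm n 1) layered (21⊕ end empty)) ,
         inj₂ (s≤s (s≤s z≤n) , σ , refl) }))
  (cardinality-image (_++ 2 + n ∷ 1 + n ∷ []) (++-cancelʳ _ _ _) (layered-count 1 n))
  where
  avoids : ∀ σ → Class 1 (2 + n) (σ ++ 2 + n ∷ 1 + n ∷ []) → Class 1 n σ → Avoids σ p312
  avoids σ (_ , _ , ¬3124) ((σ↭ , _) , _) 312∈σ with contains-312⁻¹ 312∈σ
  ... | x , y , z , s , y<z , z<x =
    ¬3124 (contains-3124 (⊆-++⁺ s (refl ∷ minimum _)) y<z z<x (m≤n⇒m≤1+n (subst (x <_) (+-comm n 1)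
      (All.lookup (range-↭-upper σ↭) (to∈ s)))))

count-1b : ∀ n → HasCardinality (Labelled 1b n) (+ F (+ n ℤ.+ + 1) ℤ.- + n ℤ.- + 1)
count-1b n = cardinality-resp-⇔
  (labelled-⇔ 1b (λ _ cls (_ , 312∈π) → class-contains-312⇒hooked cls 312∈π)
                 (λ _ hooked → hooked-class hooked , nonempty hooked , hooked-contains-312 hooked))
  (hooked-count 1 n)
  where
  nonempty : Hooked a n π → 1 ≤ n
  nonempty (end (mk _ _)) = s≤s z≤n
  nonempty (1⊕ _)         = s≤s z≤n
  nonempty (21⊕ _)        = s≤s z≤n

-- For `k = j + n + 1` the index `n - k - 1` is `-(j + 2)`: `F` is 1 at `j = 0`, where the identity
-- is counted, and 0 beyond.
F-above : ∀ j n → F (+ n ℤ.- + (j + suc n) ℤ.- + 1) ≡ F ℤ.-[1+ suc j ]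
F-above j n = trans (cong (λ z → F (z ℤ.- + 1)) (cancel (+ j) (+ n)))
                    (cong (λ i → F ℤ.-[1+ suc i ]) (+-identityʳ j))
  where
  cancel : ∀ i j → j ℤ.- (i ℤ.+ (+ 1 ℤ.+ j)) ≡ ℤ.- (+ 1 ℤ.+ i)
  cancel = ℤ-Solver.solve-∀

F-below : ∀ m k → F (+ (m + k) ℤ.- + k ℤ.- + 1) ≡ F (+ m ℤ.- + 1)
F-below m k = cong (λ z → F (z ℤ.- + 1)) (cancel (+ m) (+ k))
  where
  cancel : ∀ i j → i ℤ.+ j ℤ.- j ≡ i
  cancel = ℤ-Solver.solve-∀

n<k⇒a+k≰n : n < k → ¬ (a + k ≤ n)
n<k⇒a+k≰n n<k a+k≤n = <⇒≱ n<k (≤-trans (m≤n+m _ _) a+k≤n)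

-- As `k` exceeds the length, `a + k ≤ n` fails, so only the identity alternative remains.
count-num-identity : ∀ n → HasCardinality (Labelled (num (suc (suc n))) (suc n)) (+ 1)
count-num-identity n = cardinality-resp-⇔
  (labelled-⇔ (num (suc (suc n)))
    (λ { π _ (_ , _ , _ , inj₁ (_ , _ , a+k≤n , _)) → contradiction a+k≤n (n<k⇒a+k≰n ≤-refl)
       ; π _ (_ , _ , _ , inj₂ (π≡ , _)) → trans π≡ (interval≡range 1 (suc n)) })
    (λ { π refl → layered-class (layered-range 1 (suc n)) ,
         s≤s z≤n , s≤s (s≤s z≤n) , layered-avoids-312 (layered-range 1 (suc n)) ,
         inj₂ (sym (interval≡range 1 (suc n)) , +-comm 1 (suc n)) }))
  (cardinality-singleton (range 1 (suc n)) λ _ → mk⇔ id id)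

count-num-large : suc n < k → HasCardinality (Labelled (num k) n) (+ 0)
count-num-large {n} {k} 1+n<k = cardinality-∅ λ
  { π (_ , _ , _ , _ , inj₁ (_ , _ , a+k≤n , _)) → n<k⇒a+k≰n (<-trans ≤-refl 1+n<k) a+k≤n
  ; π (_ , _ , _ , _ , inj₂ (_ , k≡n+1)) → <⇒≢ 1+n<k (sym (trans k≡n+1 (+-comm n 1))) }

-- When `k` is the whole length, the label would need an entry `a ≤ 0`, but the values start at 1.
count-num-length : ∀ n → HasCardinality (Labelled (num n) n) (+ 0)
count-num-length n = cardinality-∅ λ
  { π (fπ , _ , _ , _ , inj₁ (xs , a , a+n≤n , refl)) →
      let (π↭ , _) , _ = to (F[321,3124]⇔Class n π) fπ in
      <⇒≱ (+-monoˡ-≤ n (All.lookup (range-↭-lower π↭) (∈-++⁺ʳ xs (here refl)))) a+n≤n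
  ; π (_ , _ , _ , _ , inj₂ (_ , n≡n+1)) → <⇒≢ (n<1+n n) (trans n≡n+1 (+-comm n 1)) }

-- Without its last `k` entries the permutation is a sum of blocks of length `m + 2` whose last
-- entry is at most `m + 1`. So its last block is 21, and before it stands an arbitrary sum of
-- length `m`.
count-num-small : ∀ m k → 1 ≤ k → HasCardinality (Labelled (num (suc k)) (suc m + suc k)) (+ F (+ m))
count-num-small m k 1≤k = cardinality-resp-⇔
  (labelled-⇔ (num (suc k)) ⇒image image⇒)
  (cardinality-image extend (++-cancelʳ _ _ _) (layered-count 1 m))
  where
  length-π = suc m + suc k

  extend : List ℕ → List ℕ
  extend σ = σ ++ 2 + m ∷ 1 + m ∷ range (3 + m) k

  2+m+k≡ : 2 + m + k ≡ length-π
  2+m+k≡ = sym (+-suc (suc m) k)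

  top : interval ((length-π ∸ suc k) + 2) length-π ≡ range (3 + m) k
  top rewrite m+n∸n≡m (suc m) (suc k) | +-comm m 2 | +-suc m k =
    trans (interval≡range (3 + m) (2 + m + k)) (cong (range (3 + m)) (m+n∸m≡n m k))

  ⇒image : ∀ π → Class 1 length-π π → HasLabel (num (suc k)) length-π π → Image extend (Layered 1 m) π
  ⇒image π cls (_ , _ , ¬312 , inj₂ (_ , k≡n+1)) =
    contradiction k≡n+1 (<⇒≢ (s≤s (≤-trans (m≤n+m (suc k) m) (m≤m+n _ 1))))
  ⇒image π cls (_ , _ , ¬312 , inj₁ (xs , a , a+k≤n , π≡)) with layered-unsnoc layered
    where
    π≡++ : π ≡ (xs ++ a ∷ []) ++ range (3 + m) k
    π≡++ = trans π≡ (trans (cong (λ ρ → xs ++ a ∷ ρ) top) (sym (++-assoc xs (a ∷ []) _)))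
    layered : Layered 1 (2 + m) (xs ++ a ∷ [])
    layered = class-avoids-312⇒layered
      (class-prefix (xs ++ a ∷ []) 2+m+k≡ (+-comm (2 + m) 1) ↭-refl
        (subst (Class 1 length-π) π≡++ cls))
      (¬312 ∘ contains-resp-⊆ (subst (_ ⊆_) (sym π≡++) (⊆-++⁺ʳ _ ⊆-refl)))
  -- A final block 1 would make `a` the maximum `m + 2` of this prefix.
  ... | inj₂ (inj₁ (_ , σ , refl , _ , eq)) = contradiction
    (+-cancelʳ-≤ (suc k) a (suc m) a+k≤n)
    (<⇒≱ (≤-reflexive (trans (+-comm 1 (suc m)) (sym (proj₂ (∷ʳ-injective xs σ eq))))))
  ... | inj₂ (inj₂ (_ , σ , refl , σ-layered , eq)) rewrite +-comm m 1 =
    σ , σ-layered , trans π≡ (trans (cong (λ ρ → xs ++ a ∷ ρ) top)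
      (trans (sym (++-assoc xs (a ∷ []) _)) (trans (cong (_++ range (3 + m) k) eq) (++-assoc σ _ _))))

  image⇒ : ∀ π → Image extend (Layered 1 m) π → Class 1 length-π π × HasLabel (num (suc k)) length-π π
  image⇒ _ (σ , σ-layered , refl) =
    layered-class π-layered ,
    s≤s z≤n , s≤s 1≤k , layered-avoids-312 π-layered ,
    inj₁ (σ ++ 2 + m ∷ [] , 1 + m , ≤-refl ,
          trans (sym (++-assoc σ (2 + m ∷ []) _))
                (cong (λ ρ → (σ ++ 2 + m ∷ []) ++ 1 + m ∷ ρ) (sym top)))
    where
    π-layered : Layered 1 length-π (extend σ)
    π-layered = layered-++ (+-suc m (suc k)) (+-comm m 1) σ-layered
                           (21⊕ layered-range (3 + m) k)

-- The comparison becomes an offset, `n = m + k` or `k = j + n + 1`. Offset 0 is the special case of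
-- each: no permutation for `k = n`, only the identity for `k = n + 1`.
count-num : ∀ n k → 2 ≤ k → HasCardinality (Labelled (num k) n) (+ F (+ n ℤ.- + k ℤ.- + 1))
count-num n k 2≤k with ≤-<-connex k n
count-num n (suc k) (s≤s 1≤k) | inj₁ k≤n with m≤n⇒∃[o]m+o≡n k≤n
... | m , k+m≡n with refl ← trans (sym k+m≡n) (+-comm (suc k) m) =
  subst (HasCardinality (Labelled (num (suc k)) (m + suc k)) ∘ +_) (sym (F-below m (suc k)))
    (count m)
  where
  count : ∀ m → HasCardinality (Labelled (num (suc k)) (m + suc k)) (+ F (+ m ℤ.- + 1))
  count zero    = count-num-length (suc k)
  count (suc m) = count-num-small m k 1≤k
count-num n k 2≤k | inj₂ n<k with m≤n⇒∃[o]m+o≡n n<k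
... | j , 1+n+j≡k with refl ← trans (sym 1+n+j≡k) (+-comm (suc n) j) =
  subst (HasCardinality (Labelled (num (j + suc n)) n) ∘ +_) (sym (F-above j n)) (count j n 2≤k)
  where
  count : ∀ j n → 2 ≤ j + suc n → HasCardinality (Labelled (num (j + suc n)) n) (+ F ℤ.-[1+ suc j ])
  count zero    (suc n) _       = count-num-identity n
  -- Length 0 would make `k` equal to 1, against `2 ≤ k`.
  count zero    zero    (s≤s ())
  count (suc j) n       _       = count-num-large (s≤s (m≤n+m (suc n) j))

proposition8p15 : (n k : ℕ) → 2 ≤ k →
    HasCardinality (Labelled 1a n) (+ F (+ n ℤ.- + 2))
    × HasCardinality (Labelled 1b n) (+ F (+ n ℤ.+ + 1) ℤ.- + n ℤ.- + 1)
    × HasCardinality (Labelled (num k) n) (+ F (+ n ℤ.- + k ℤ.- + 1))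
    × HasCardinality (F[321,3124] n) (+ F (+ n ℤ.+ + 2) ℤ.- + n ℤ.- + 1)
proposition8p15 n k 2≤k =
  count-1a n , count-1b n , count-num n k 2≤k ,
  cardinality-resp-⇔ (λ π → mk⇔ (from (F[321,3124]⇔Class n π)) (to (F[321,3124]⇔Class n π)))
    (class-count 1 n)
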